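{- Let $K$ be a field and let $G$ be a finite simple graph without isolated vertices with $|E_G|>1$. Fix a grevlex order on $K[E_G]$ and let $\mathscr{G}=\mathscr{T}\cup\mathscr{E}$ be the Gröbner basis of the Eulerian ideal $I(X_G)$ consisting of $\mathscr{T}=\{t_h^2-t_\ell^2 : h,\ell\in E_G\}$ and the set $\mathscr{E}$ of Eulerian binomials. Let $\mathbf{t}^\delta,\mathbf{t}^\gamma$ be monomials in $K[E_G]$. (i) If the monomial $\mathbf{t}^\delta$ is the remainder of the division of $\mathbf{t}^\gamma$ by an element of $\mathscr{G}$, then $\theta(\mathbf{t}^\delta)=\theta(\mathbf{t}^\gamma)$ and $|\mathcal{J}(\mathbf{t}^\delta)|\equiv|\mathcal{J}(\mathbf{t}^\gamma)| \pmod 2$. (ii) The remainder in a standard expression of $\mathbf{t}^\gamma$ with respect to $\mathscr{G}$ is a monomial $\mathbf{t}^\delta$ with $$|\mathcal{J}(\mathbf{t}^\delta)|=\min\{|J| : J \text{ is a } \theta(\mathbf{t}^\gamma)\text{ -join and } |J|\equiv|\mathcal{J}(\mathbf{t}^\gamma)| \pmod 2\}.$$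
   Context: $G$ has vertex set $V_G$ and edge set $E_G$, a non-empty set of $2$-element subsets of $V_G$. Put $K[V_G]=K[x_i : i\in V_G]$ and $K[E_G]=K[t_h : h\in E_G]$. Let $\varphi\colon K[E_G]\to K[V_G]$ be the $K$-algebra homomorphism with $\varphi(t_h)=x_ix_j$ for $h=\{i,j\}\in E_G$. The Eulerian ideal of $G$ is $I(X_G)=\varphi^{ -1}\big((x_i^2-x_j^2 : i,j\in V_G)\big)\subset K[E_G]$. For $\alpha\colon E_G\to\mathbb{N}$, write $\mathbf{t}^\alpha=\prod_{h\in E_G}t_h^{\alpha(h)}$ and $\mathcal{J}(\mathbf{t}^\alpha)=\{h\in E_G : \alpha(h)\text{ is odd}\}$. Let $\theta(\mathbf{t}^\alpha)\subset V_G$ be the set of odd degree vertices of the subgraph of $G$ edge-induced by $\mathcal{J}(\mathbf{t}^\alpha)$. For $T\subset V_G$ (possibly empty), a $T$-join is a subset $J\subset E_G$ such that $T$ is precisely the set of odd degree vertices of the subgraph edge-induced by $J$. A subgraph of $G$ is called even Eulerian if all its vertices have even degree in the subgraph and its edge set has even cardinality (it need be neither connected nor spanning). A binomial $\mathbf{t}^\alpha-\mathbf{t}^\beta$ is called Eulerian if $\mathbf{t}^\alpha$ and $\mathbf{t}^\beta$ are distinct, relatively prime, square-free monomials of the same degree and the subgraph edge-induced by $\mathcal{J}(\mathbf{t}^\alpha)\cup\mathcal{J}(\mathbf{t}^\beta)$ is an even Eulerian subgraph of $G$. A grevlex order on $K[E_G]$ is the graded reverse lexicographic order induced by $t_{\epsilon(1)}\succ\cdots\succ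 t_{\epsilon(s)}$, where $s=|E_G|$ and $\epsilon\colon\{1,\dots,s\}\to E_G$ is a bijection. It is known that $\mathscr{G}$ is a Gröbner basis of $I(X_G)$ for any such order (the zero polynomial obtained in $\mathscr{T}$ when $h=\ell$ is disregarded). A division of a monomial $\mathbf{t}^\gamma$ by $g\in\mathscr{G}$ with leading term dividing $\mathbf{t}^\gamma$ replaces that leading monomial factor by the other monomial of $g$. A standard expression of $f$ with respect to $\mathscr{G}$ is an expression $f=\sum_{g\in\mathscr{G}}q_g g+r$ as produced by the division algorithm: no monomial of the remainder $r$ is divisible by a leading monomial of an element of $\mathscr{G}$, and the leading monomial of each nonzero $q_g g$ is at most that of $f$. -}

module Defs where

open import Algebra.Apartness.Bundles using (HeytingField)
open import Data.Bool.Base using (if_then_else_)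
open import Data.Fin.Base as Fin using (Fin)
open import Data.Fin.Permutation using (Permutation′; _⟨$⟩ʳ_)
open import Data.Fin.Subset using (Subset; _∈_; _∩_; _∪_; ∣_∣)
open import Data.List.Base as List using (List; []; _∷_; _++_; foldr; concatMap)
open import Data.Nat.Base using (ℕ; _+_; _≤_; _<_; parity)
import Data.Nat.Properties as ℕ
open import Data.Parity.Base using (0ℙ; 1ℙ)
import Data.Parity.Properties as Parity
open import Data.Product.Base using (∃-syntax; _×_; _,_)
open import Data.Sum.Base using (_⊎_)
open import Data.Vec.Base as Vec using (Vec; lookup; tabulate; replicate; zipWith; _[_]≔_)
open import Data.Vec.Properties using (≡-dec)
open import Function.Definitions using (Injective)
open import Level using (Level; _⊔_)
open import Relation.Binary.Definitions using (DecidableEquality)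
open import Relation.Binary.PropositionalEquality.Core using (_≡_; _≢_)
open import Relation.Nullary.Decidable.Core using (does)
open import Relation.Nullary.Negation.Core using (¬_)

-- The vertex set is Fin #V, and the edge set is the image of the injection
-- `ends`, whose index type Fin #E stands for E_G.
record Graph : Set where
  field
    #V #E          : ℕ
    ends           : Fin #E → Subset #V
    ∣ends∣≡2       : ∀ h → ∣ ends h ∣ ≡ 2
    ends-injective : Injective _≡_ _≡_ ends

  NoIsolatedVertices : Set
  NoIsolatedVertices = ∀ v → ∃[ h ] v ∈ ends h

  incident : Fin #V → Subset #E
  incident v = tabulate (λ h → lookup (ends h) v)

  -- The degree of v in the subgraph edge-induced by J; it is 0 when v is not
  -- a vertex of that subgraph.
  degree : Subset #E → Fin #V → ℕ
  degree J v = ∣ J ∩ incident v ∣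

  oddVertices : Subset #E → Subset #V
  oddVertices J = tabulate (λ v → does (parity (degree J v) Parity.≟ 1ℙ))

  IsJoin : Subset #V → Subset #E → Set
  IsJoin T J = T ≡ oddVertices J

  EvenEulerian : Subset #E → Set
  EvenEulerian J = (∀ v → parity (degree J v) ≡ 0ℙ) × parity ∣ J ∣ ≡ 0ℙ

-- Monomials in s variables, as exponent vectors.
Monomial : ℕ → Set
Monomial s = Vec ℕ s

module _ {s : ℕ} where

  infixl 7 _·_
  infix  4 _∣_ _≟_

  𝟙 : Monomial s
  𝟙 = replicate s 0

  var² : Fin s → Monomial s
  var² h = 𝟙 [ h ]≔ 2

  _·_ : Monomial s → Monomial s → Monomial s
  _·_ = zipWith _+_

  _∣_ : Monomial s → Monomial s → Set
  α ∣ β = ∃[ ν ] β ≡ ν · α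

  _≟_ : DecidableEquality (Monomial s)
  _≟_ = ≡-dec ℕ._≟_

  deg : Monomial s → ℕ
  deg = Vec.sum

  SquareFree : Monomial s → Set
  SquareFree α = ∀ h → lookup α h ≤ 1

  RelativelyPrime : Monomial s → Monomial s → Set
  RelativelyPrime α β = ∀ μ → μ ∣ α → μ ∣ β → μ ≡ 𝟙

  𝒥 : Monomial s → Subset s
  𝒥 α = tabulate (λ h → does (parity (lookup α h) Parity.≟ 1ℙ))

  -- Graded reverse lexicographic order with t_ε(1) ≻ ⋯ ≻ t_ε(s): among
  -- monomials of equal degree, β precedes α when at the last position where
  -- they differ α has the smaller exponent.
  module Grevlex (ε : Permutation′ s) where

    infix 4 _≺_ _≼_

    _≺_ : Monomial s → Monomial s → Set
    β ≺ α = deg β < deg α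
          ⊎ (deg β ≡ deg α
             × ∃[ i ] (lookup α (ε ⟨$⟩ʳ i) < lookup β (ε ⟨$⟩ʳ i)
                       × (∀ j → i Fin.< j → lookup α (ε ⟨$⟩ʳ j) ≡ lookup β (ε ⟨$⟩ʳ j))))

    _≼_ : Monomial s → Monomial s → Set
    β ≼ α = β ≺ α ⊎ β ≡ α

module _ (G : Graph) where
  open Graph G

  θ : Monomial #E → Subset #V
  θ α = oddVertices (𝒥 α)

  EulerianPair : Monomial #E → Monomial #E → Set
  EulerianPair α β =
      α ≢ β
    × RelativelyPrime α β
    × SquareFree α
    × SquareFree β
    × deg α ≡ deg β
    × EvenEulerian (𝒥 α ∪ 𝒥 β)

IsMinimum : (ℕ → Set) → ℕ → Set
IsMinimum P m = P m × (∀ k → P k → m ≤ k)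

-- Constructively a field is a Heyting field: x # 0# is the positive form of
-- "x is non-zero", and tightness says that an element not apart from 0# is
-- zero. Classically these are exactly the fields, with x # y meaning x ≠ y.
module Polynomials {c ℓ₁ ℓ₂ : Level} (K : HeytingField c ℓ₁ ℓ₂) where
  private module K = HeytingField K

  -- Formal sums of terms, in which a monomial may occur repeatedly or with
  -- coefficient zero; polynomials are identified by _≈_ below.
  Polynomial : ℕ → Set c
  Polynomial s = List (K.Carrier × Monomial s)

  module _ {s : ℕ} where

    infix  4 _≈_
    infixl 6 _⊕_ _⊖_
    infixl 7 _⊛_

    coeff : Polynomial s → Monomial s → K.Carrier
    coeff []            μ = K.0#
    coeff ((a , α) ∷ f) μ = (if does (α ≟ μ) then a else K.0#) K.+ coeff f μ

    _≈_ : Polynomial s → Polynomial s → Set ℓ₁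
    f ≈ g = ∀ μ → coeff f μ K.≈ coeff g μ

    t^ : Monomial s → Polynomial s
    t^ α = (K.1# , α) ∷ []

    _⊕_ : Polynomial s → Polynomial s → Polynomial s
    _⊕_ = _++_

    _⊖_ : Polynomial s → Polynomial s → Polynomial s
    f ⊖ g = f ⊕ List.map (λ (b , β) → (K.- b , β)) g

    _⊛_ : Polynomial s → Polynomial s → Polynomial s
    f ⊛ g = concatMap (λ (a , α) → List.map (λ (b , β) → (a K.* b , α · β)) g) f

    ∑ : {k : ℕ} → (Fin k → Polynomial s) → Polynomial s
    ∑ f = foldr _⊕_ [] (List.tabulate f)

    _OccursIn_ : Monomial s → Polynomial s → Set ℓ₂
    μ OccursIn f = coeff f μ K.# K.0#

    module Division (ε : Permutation′ s) where
      open Grevlex ε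

      -- The zero polynomial has no leading monomial.
      IsLeadingMonomial : Polynomial s → Monomial s → Set ℓ₂
      IsLeadingMonomial f μ = μ OccursIn f × (∀ ν → ν OccursIn f → ν ≼ μ)

      -- One division of t^γ by a binomial g, with leading monomial `lead` and
      -- other monomial `other`, leaving t^δ.
      DivisionBy : Polynomial s → Monomial s → Monomial s → Set ℓ₂
      DivisionBy g γ δ =
        ∃[ lead ] ∃[ other ] ∃[ ν ]
            IsLeadingMonomial g lead
          × other OccursIn g
          × other ≢ lead
          × γ ≡ ν · lead
          × δ ≡ ν · other

      -- f = ∑ q_g g + r over distinct elements g of B; those not listed have
      -- q_g = 0.
      record StandardExpression {ℓ : Level} (B : Polynomial s → Set ℓ)
                                (f r : Polynomial s) : Set (c ⊔ ℓ₁ ⊔ ℓ₂ ⊔ ℓ) where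
        field
          size       : ℕ
          g q        : Fin size → Polynomial s
          g∈B        : ∀ i → B (g i)
          g-distinct : ∀ i j → g i ≈ g j → i ≡ j
          expression : f ≈ ∑ (λ i → q i ⊛ g i) ⊕ r
          reduced    : ∀ μ → μ OccursIn r →
                       ∀ b lead → B b → IsLeadingMonomial b lead → ¬ (lead ∣ μ)
          bounded    : ∀ i μ → IsLeadingMonomial (q i ⊛ g i) μ →
                       ∃[ lead ] (IsLeadingMonomial f lead × μ ≼ lead)

  module _ (G : Graph) where
    open Graph G

    -- For h = ℓ this contains the zero polynomial, which has no leading
    -- monomial and contributes nothing to a standard expression.
    𝒯 : Polynomial #E → Set ℓ₁
    𝒯 f = ∃[ h ] ∃[ ℓ ] f ≈ t^ (var² h) ⊖ t^ (var² ℓ)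

    ℰ : Polynomial #E → Set ℓ₁
    ℰ f = ∃[ α ] ∃[ β ] (EulerianPair G α β × f ≈ t^ α ⊖ t^ β)

    𝒢 : Polynomial #E → Set ℓ₁
    𝒢 f = 𝒯 f ⊎ ℰ f

{-# OPTIONS --safe #-}

-- Call monomials equivalent when they have the same degree and the same θ. Every
-- element of 𝒢 is a difference of two equivalent monomials, which gives (i) and
-- shows that subtracting multiples of elements of 𝒢 from t^γ preserves the sum of
-- the coefficients over each class. Exchanging half of an even Eulerian subgraph
-- inside 𝒥(δ) △ J shows that an irreducible monomial t^δ has |𝒥(δ)| minimal
-- among joins J of the same parity, and that each class contains at most one
-- irreducible monomial. The remainder, supported on irreducible monomials, is
-- therefore determined by its class sums: it is the irreducible t^δ equivalent
-- to t^γ. The monomial is found in the remainder itself by cotransitivity of #,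
-- so neither decidable equality in K nor a search for a normal form is needed.

module Submission where

open import Defs
open import Algebra.Apartness.Bundles using (HeytingField; module HeytingCommutativeRing)
import Algebra.Apartness.Properties.HeytingCommutativeRing as HeytingProperties
open import Algebra.Bundles using (module CommutativeRing)
import Algebra.Properties.CommutativeSemigroup as CommutativeSemigroupProperties
import Algebra.Properties.Ring as RingProperties
open import Data.Bool.Base using (Bool; true; false; not; _∧_; _xor_; if_then_else_)
import Data.Bool.Properties as Bool
open import Data.Empty using (⊥; ⊥-elim)
open import Data.Fin.Base as Fin using (Fin; zero; suc)
open import Data.Fin.Permutation using (Permutation′; _⟨$⟩ʳ_; _⟨$⟩ˡ_; inverseˡ; inverseʳ)
import Data.Fin.Properties as Fin
open import Data.Fin.Subset as Subset
  using (Subset; _∈_; _∉_; _⊆_; _∩_; _∪_; _─_; _-_; ∣_∣)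
open import Data.Fin.Subset.Properties
  using ( _∈?_; drop-there; out⊆; in⊆in; ⊥⊆; ⊆-antisym; ∣⊥∣≡0; x∈⁅x⁆; ∪-comm
        ; x∈p∪q⁻; x∈p∪q⁺; p⊆p∪q; q⊆p∪q; p─⊥≡p; p─q⊆p; x∈p∧x∉q⇒x∈p─q )
open import Data.List.Base as List using ([]; _∷_)
open import Data.Nat.Base using (ℕ; zero; suc; _+_; _∸_; _≤_; _<_; z≤n; s≤s; s≤s⁻¹; parity)
import Data.Nat.Properties as ℕ
open import Data.Parity.Base as ℙ using (Parity; 0ℙ; 1ℙ)
import Data.Parity.Properties as Parity
open import Data.Product.Base using (∃-syntax; _×_; _,_; proj₁; proj₂)
open import Data.Sum.Base using (_⊎_; inj₁; inj₂)
open import Data.Vec.Base as Vec using (Vec; []; _∷_; here; there; lookup; tabulate; _[_]≔_)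
open import Data.Vec.Properties
  using ( ≡-dec; lookup⇒[]=; []=⇒lookup; lookup-map; lookup-zipWith; lookup-replicate
        ; lookup∘update; lookup∘update′; lookup∘tabulate; tabulate∘lookup; tabulate-cong )
open import Function.Base using (_∘_; _$_)
open import Function.Bundles using (mk⇔)
open import Relation.Binary.PropositionalEquality
  using (_≡_; _≢_; refl; sym; trans; cong; cong₂; subst)
open import Relation.Nullary.Decidable
  using (Dec; does; yes; no; _×-dec_; map′; dec-true; dec-false; does-⇔)
open import Relation.Nullary.Negation.Core using (¬_; contradiction)
open import Relation.Unary using (Pred; Decidable)

private variable
  n : ℕ

-- Extensionality of vectors and finite search.

lookup-ext : ∀ {A : Set} {xs ys : Vec A n} → (∀ i → lookup xs i ≡ lookup ys i) → xs ≡ ys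
lookup-ext {xs = xs} {ys} eq =
  trans (sym (tabulate∘lookup xs)) (trans (tabulate-cong eq) (tabulate∘lookup ys))

-- Read through `ε`, the index found in a symmetric difference is the position at which grevlex
-- compares its two halves.
last : ∀ {ℓ} {P : Pred (Fin n) ℓ} → Decidable P →
       (∀ i → ¬ P i) ⊎ (∃[ i ] (P i × (∀ j → i Fin.< j → ¬ P j)))
last {n = zero}  P? = inj₁ λ ()
last {n = suc n} P? with last (P? ∘ suc)
... | inj₂ (i , Pi , above) = inj₂ (suc i , Pi , λ { zero () ; (suc j) (s≤s i<j) → above j i<j })
... | inj₁ none with P? zero
...   | yes P0 = inj₂ (zero , P0 , λ { zero () ; (suc j) _ → none j })
...   | no ¬P0 = inj₁ λ { zero → ¬P0 ; (suc j) → none j }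

-- Symmetric differences and sizes of finite subsets.

infixl 6 _△_
_△_ : Subset n → Subset n → Subset n
p △ q = (p ─ q) ∪ (q ─ p)

x∈p─q⇒x∉q : ∀ (p q : Subset n) {x} → x ∈ p ─ q → x ∉ q
x∈p─q⇒x∉q (_ ∷ p) (true  ∷ q) (there x∈) (there x∈q) = x∈p─q⇒x∉q p q x∈ x∈q
x∈p─q⇒x∉q (_ ∷ p) (false ∷ q) (there x∈) (there x∈q) = x∈p─q⇒x∉q p q x∈ x∈q

△-empty⇒≡ : {p q : Subset n} → (∀ x → x ∉ p △ q) → p ≡ q
△-empty⇒≡ {p = p} {q} empty = ⊆-antisym (included p q (p⊆p∪q _)) (included q p (q⊆p∪q _ _))
  where
  included : ∀ a b → a ─ b ⊆ p △ q → a ⊆ b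
  included a b incl {x} x∈a with x ∈? b
  ... | yes x∈b = x∈b
  ... | no  x∉b = contradiction (incl (x∈p∧x∉q⇒x∈p─q x∈a x∉b)) (empty x)

disjoint⇒∪≡△ : {p q : Subset n} → (∀ {x} → x ∈ p → x ∉ q) → p ∪ q ≡ p △ q
disjoint⇒∪≡△ {p = p} {q} disj = ⊆-antisym to from
  where
  to : p ∪ q ⊆ p △ q
  to x∈ with x∈p∪q⁻ p q x∈
  ... | inj₁ x∈p = x∈p∪q⁺ (inj₁ (x∈p∧x∉q⇒x∈p─q x∈p (disj x∈p)))
  ... | inj₂ x∈q = x∈p∪q⁺ (inj₂ (x∈p∧x∉q⇒x∈p─q x∈q λ x∈p → disj x∈p x∈q))
  from : p △ q ⊆ p ∪ q
  from x∈ with x∈p∪q⁻ (p ─ q) (q ─ p) x∈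
  ... | inj₁ x∈p = x∈p∪q⁺ (inj₁ (p─q⊆p p q x∈p))
  ... | inj₂ x∈q = x∈p∪q⁺ (inj₂ (p─q⊆p q p x∈q))

q⊆p⇒q∪[p─q]≡p : {p q : Subset n} → q ⊆ p → q ∪ (p ─ q) ≡ p
q⊆p⇒q∪[p─q]≡p {p = p} {q} q⊆p = ⊆-antisym to from
  where
  to : q ∪ (p ─ q) ⊆ p
  to x∈ with x∈p∪q⁻ q (p ─ q) x∈
  ... | inj₁ x∈q = q⊆p x∈q
  ... | inj₂ x∈p = p─q⊆p p q x∈p
  from : p ⊆ q ∪ (p ─ q)
  from {x} x∈p with x ∈? q
  ... | yes x∈q = x∈p∪q⁺ (inj₁ x∈q)
  ... | no  x∉q = x∈p∪q⁺ (inj₂ (x∈p∧x∉q⇒x∈p─q x∈p x∉q))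

∣△∣ : ∀ (p q : Subset n) → ∣ p △ q ∣ ≡ ∣ p ─ q ∣ + ∣ q ─ p ∣
∣△∣ []          []          = refl
∣△∣ (true  ∷ p) (true  ∷ q) = ∣△∣ p q
∣△∣ (true  ∷ p) (false ∷ q) = cong suc (∣△∣ p q)
∣△∣ (false ∷ p) (true  ∷ q) = trans (cong suc (∣△∣ p q)) (sym (ℕ.+-suc _ _))
∣△∣ (false ∷ p) (false ∷ q) = ∣△∣ p q

-- Both sides count `p ∪ q`.
∣p─q∣+∣q∣≡∣q─p∣+∣p∣ : ∀ (p q : Subset n) → ∣ p ─ q ∣ + ∣ q ∣ ≡ ∣ q ─ p ∣ + ∣ p ∣
∣p─q∣+∣q∣≡∣q─p∣+∣p∣ []          []          = refl
∣p─q∣+∣q∣≡∣q─p∣+∣p∣ (true  ∷ p) (true  ∷ q) =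
  trans (ℕ.+-suc _ _) (trans (cong suc (∣p─q∣+∣q∣≡∣q─p∣+∣p∣ p q)) (sym (ℕ.+-suc _ _)))
∣p─q∣+∣q∣≡∣q─p∣+∣p∣ (true  ∷ p) (false ∷ q) =
  trans (cong suc (∣p─q∣+∣q∣≡∣q─p∣+∣p∣ p q)) (sym (ℕ.+-suc _ _))
∣p─q∣+∣q∣≡∣q─p∣+∣p∣ (false ∷ p) (true  ∷ q) =
  trans (ℕ.+-suc _ _) (cong suc (∣p─q∣+∣q∣≡∣q─p∣+∣p∣ p q))
∣p─q∣+∣q∣≡∣q─p∣+∣p∣ (false ∷ p) (false ∷ q) = ∣p─q∣+∣q∣≡∣q─p∣+∣p∣ p q

q⊆p⇒∣q∣+∣p─q∣≡∣p∣ : {p q : Subset n} → q ⊆ p → ∣ q ∣ + ∣ p ─ q ∣ ≡ ∣ p ∣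
q⊆p⇒∣q∣+∣p─q∣≡∣p∣ {p = []}        {[]}        _   = refl
q⊆p⇒∣q∣+∣p─q∣≡∣p∣ {p = true ∷ p}  {true ∷ q}  q⊆p =
  cong suc (q⊆p⇒∣q∣+∣p─q∣≡∣p∣ (drop-there ∘ q⊆p ∘ there))
q⊆p⇒∣q∣+∣p─q∣≡∣p∣ {p = true ∷ p}  {false ∷ q} q⊆p =
  trans (ℕ.+-suc _ _) (cong suc (q⊆p⇒∣q∣+∣p─q∣≡∣p∣ (drop-there ∘ q⊆p ∘ there)))
q⊆p⇒∣q∣+∣p─q∣≡∣p∣ {p = false ∷ p} {true ∷ q}  q⊆p = contradiction (q⊆p here) λ ()
q⊆p⇒∣q∣+∣p─q∣≡∣p∣ {p = false ∷ p} {false ∷ q} q⊆p =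
  q⊆p⇒∣q∣+∣p─q∣≡∣p∣ (drop-there ∘ q⊆p ∘ there)

∣p∣≤1+∣p-x∣ : ∀ (p : Subset n) x → ∣ p ∣ ≤ suc ∣ p - x ∣
∣p∣≤1+∣p-x∣ (true  ∷ p) zero    = s≤s (ℕ.≤-reflexive (cong ∣_∣ (sym (p─⊥≡p p))))
∣p∣≤1+∣p-x∣ (false ∷ p) zero    =
  ℕ.≤-trans (ℕ.≤-reflexive (cong ∣_∣ (sym (p─⊥≡p p)))) (ℕ.n≤1+n _)
∣p∣≤1+∣p-x∣ (true  ∷ p) (suc x) = s≤s (∣p∣≤1+∣p-x∣ p x)
∣p∣≤1+∣p-x∣ (false ∷ p) (suc x) = ∣p∣≤1+∣p-x∣ p x

subset-of-size : ∀ (p : Subset n) {k} → k ≤ ∣ p ∣ → ∃[ q ] (q ⊆ p × ∣ q ∣ ≡ k)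
subset-of-size {n} p {zero} _ = Subset.⊥ , ⊥⊆ , ∣⊥∣≡0 n
subset-of-size (true ∷ p) {suc k} (s≤s k≤) with subset-of-size p k≤
... | q , q⊆p , eq = true ∷ q , in⊆in q⊆p , cong suc eq
subset-of-size (false ∷ p) {suc k} k≤ with subset-of-size p k≤
... | q , q⊆p , eq = false ∷ q , out⊆ q⊆p , eq

-- Parities of cardinalities.

toℙ : Bool → Parity
toℙ b = if b then 1ℙ else 0ℙ

parity-∣∷∣ : ∀ b (p : Subset n) → parity ∣ b ∷ p ∣ ≡ toℙ b ℙ.+ parity ∣ p ∣
parity-∣∷∣ true  p = Parity.+-homo-+ 1 ∣ p ∣
parity-∣∷∣ false p = refl

-- Common elements count twice on the right and not at all on the left.
parity-∣△∣ : ∀ (p q : Subset n) → parity ∣ p △ q ∣ ≡ parity ∣ p ∣ ℙ.+ parity ∣ q ∣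
parity-∣△∣ []      []      = refl
parity-∣△∣ (x ∷ p) (y ∷ q)
  rewrite parity-∣∷∣ x p | parity-∣∷∣ y q
  = trans (step x y) (regroup x y (parity ∣ p ∣) (parity ∣ q ∣))
  where
  step : ∀ x y → parity ∣ (x ∷ p) △ (y ∷ q) ∣ ≡ toℙ (x xor y) ℙ.+ (parity ∣ p ∣ ℙ.+ parity ∣ q ∣)
  step true  true  = parity-∣△∣ p q
  step true  false = trans (parity-∣∷∣ true (p △ q)) (cong (1ℙ ℙ.+_) (parity-∣△∣ p q))
  step false true  = trans (parity-∣∷∣ true (p △ q)) (cong (1ℙ ℙ.+_) (parity-∣△∣ p q))
  step false false = parity-∣△∣ p q
  regroup : ∀ x y a b → toℙ (x xor y) ℙ.+ (a ℙ.+ b) ≡ (toℙ x ℙ.+ a) ℙ.+ (toℙ y ℙ.+ b)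
  regroup true  true  0ℙ 0ℙ = refl
  regroup true  true  0ℙ 1ℙ = refl
  regroup true  true  1ℙ 0ℙ = refl
  regroup true  true  1ℙ 1ℙ = refl
  regroup true  false 0ℙ _  = refl
  regroup true  false 1ℙ 0ℙ = refl
  regroup true  false 1ℙ 1ℙ = refl
  regroup false true  0ℙ _  = refl
  regroup false true  1ℙ 0ℙ = refl
  regroup false true  1ℙ 1ℙ = refl
  regroup false false _  _  = refl

∩-distribʳ-△ : ∀ (s p q : Subset n) → (p △ q) ∩ s ≡ (p ∩ s) △ (q ∩ s)
∩-distribʳ-△ []       []      []      = refl
∩-distribʳ-△ (s ∷ ss) (x ∷ p) (y ∷ q) with s | x | y | ∩-distribʳ-△ ss p q
... | true  | true  | true  | ih = cong (false ∷_) ih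
... | true  | true  | false | ih = cong (true ∷_) ih
... | true  | false | true  | ih = cong (true ∷_) ih
... | true  | false | false | ih = cong (false ∷_) ih
... | false | true  | true  | ih = cong (false ∷_) ih
... | false | true  | false | ih = cong (false ∷_) ih
... | false | false | true  | ih = cong (false ∷_) ih
... | false | false | false | ih = cong (false ∷_) ih

parity≡0⇒double : ∀ n → parity n ≡ 0ℙ → ∃[ k ] n ≡ k + k
parity≡0⇒double zero          _  = 0 , refl
parity≡0⇒double (suc (suc n)) eq with parity≡0⇒double n eq
... | k , refl = suc k , cong suc (sym (ℕ.+-suc k k))

+-≡0⇒≡ : ∀ {a b} → a ℙ.+ b ≡ 0ℙ → a ≡ b
+-≡0⇒≡ {0ℙ} {0ℙ} _ = refl
+-≡0⇒≡ {1ℙ} {1ℙ} _ = refl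

≡⇒+-≡0 : ∀ {a b} → a ≡ b → a ℙ.+ b ≡ 0ℙ
≡⇒+-≡0 {a} refl = Parity.p+p≡0ℙ a

isOdd-injective : ∀ {a b} → does (a Parity.≟ 1ℙ) ≡ does (b Parity.≟ 1ℙ) → a ≡ b
isOdd-injective {0ℙ} {0ℙ} _ = refl
isOdd-injective {1ℙ} {1ℙ} _ = refl

-- Monomials: divisibility, odd parts and degrees.

module _ {s : ℕ} where

  lookup-· : ∀ (α β : Monomial s) h → lookup (α · β) h ≡ lookup α h + lookup β h
  lookup-· α β h = lookup-zipWith _+_ h α β

  ∣⇒≤ : ∀ {α β : Monomial s} → α ∣ β → ∀ h → lookup α h ≤ lookup β h
  ∣⇒≤ {α} (ν , refl) h = ℕ.≤-trans (ℕ.m≤n+m _ _) (ℕ.≤-reflexive (sym (lookup-· ν α h)))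

  ≤⇒∣ : ∀ {α β : Monomial s} → (∀ h → lookup α h ≤ lookup β h) → α ∣ β
  ≤⇒∣ {α} {β} le = Vec.zipWith _∸_ β α , lookup-ext λ h → sym (trans
    (lookup-· (Vec.zipWith _∸_ β α) α h)
    (trans (cong (_+ lookup α h) (lookup-zipWith _∸_ h β α)) (ℕ.m∸n+n≡m (le h))))

  x∈𝒥⁻ : ∀ (α : Monomial s) {h} → h ∈ 𝒥 α → parity (lookup α h) ≡ 1ℙ
  x∈𝒥⁻ α {h} h∈ = isOdd-injective (trans (sym (lookup∘tabulate _ h)) ([]=⇒lookup h∈))

  x∈𝒥⇒1≤ : ∀ (α : Monomial s) {h} → h ∈ 𝒥 α → 1 ≤ lookup α h
  x∈𝒥⇒1≤ α {h} h∈ with lookup α h | x∈𝒥⁻ α h∈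
  ... | suc _ | _ = s≤s z≤n

  𝒥≡⇒parity≡ : ∀ {α β : Monomial s} → 𝒥 α ≡ 𝒥 β → ∀ h → parity (lookup α h) ≡ parity (lookup β h)
  𝒥≡⇒parity≡ eq h = isOdd-injective
    (trans (sym (lookup∘tabulate _ h)) (trans (cong (λ J → lookup J h) eq) (lookup∘tabulate _ h)))

-- Each exponent is congruent modulo 2 to the indicator of its being odd; summing gives the degree
-- on one side and the size of `𝒥 α` on the other.
parity-∣𝒥∣ : ∀ (α : Monomial n) → parity ∣ 𝒥 α ∣ ≡ parity (deg α)
parity-∣𝒥∣ []      = refl
parity-∣𝒥∣ (x ∷ α) = trans (parity-∣∷∣ (does (parity x Parity.≟ 1ℙ)) (𝒥 α))
  (trans (cong₂ ℙ._+_ (toℙ-isOdd (parity x)) (parity-∣𝒥∣ α)) (sym (Parity.+-homo-+ x (deg α))))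
  where
  toℙ-isOdd : ∀ a → toℙ (does (a Parity.≟ 1ℙ)) ≡ a
  toℙ-isOdd 0ℙ = refl
  toℙ-isOdd 1ℙ = refl

𝒥-· : ∀ (α β : Monomial n) → 𝒥 (α · β) ≡ 𝒥 α △ 𝒥 β
𝒥-· []      []      = refl
𝒥-· (x ∷ α) (y ∷ β) rewrite Parity.+-homo-+ x y with parity x | parity y
... | 0ℙ | 0ℙ = cong (false ∷_) (𝒥-· α β)
... | 0ℙ | 1ℙ = cong (true  ∷_) (𝒥-· α β)
... | 1ℙ | 0ℙ = cong (true  ∷_) (𝒥-· α β)
... | 1ℙ | 1ℙ = cong (false ∷_) (𝒥-· α β)

deg-· : ∀ (α β : Monomial n) → deg (α · β) ≡ deg α + deg β
deg-· []      []      = refl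
deg-· (x ∷ α) (y ∷ β) = trans (cong (x + y +_) (deg-· α β)) (interchange x y (deg α) (deg β))
  where open CommutativeSemigroupProperties ℕ.+-commutativeSemigroup using (interchange)

deg-[]≔ : ∀ (h : Fin n) k → deg (𝟙 [ h ]≔ k) ≡ k
deg-[]≔ {suc n} zero    k = trans (cong (k +_) (deg-𝟙 n)) (ℕ.+-identityʳ k)
  where
  deg-𝟙 : ∀ m → deg (𝟙 {m}) ≡ 0
  deg-𝟙 zero    = refl
  deg-𝟙 (suc m) = deg-𝟙 m
deg-[]≔ (suc h) k = deg-[]≔ h k

-- Cancelling the agreeing exponents from the two degrees leaves the exponents at `l`.
deg-injective-at : ∀ {α β : Monomial n} l → (∀ h → h ≢ l → lookup α h ≡ lookup β h) →
                   deg α ≡ deg β → α ≡ β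
deg-injective-at {α = x ∷ α} {y ∷ β} zero    agree eq
  with refl ← lookup-ext {xs = α} {β} (λ h → agree (suc h) λ ()) =
  cong (_∷ α) (ℕ.+-cancelʳ-≡ (deg α) x y eq)
deg-injective-at {α = x ∷ α} {y ∷ β} (suc l) agree eq with refl ← agree zero (λ ()) =
  cong (x ∷_) (deg-injective-at l (λ h h≢l → agree (suc h) (h≢l ∘ Fin.suc-injective))
                                  (ℕ.+-cancelˡ-≡ x _ _ eq))

-- Square-free monomials and coprimality.

χ : Subset n → Monomial n
χ = Vec.map (λ b → if b then 1 else 0)

lookup-χ-∈ : ∀ {p : Subset n} {h} → h ∈ p → lookup (χ p) h ≡ 1
lookup-χ-∈ {p = p} {h} h∈ = trans (lookup-map h _ p) (cong (if_then 1 else 0) ([]=⇒lookup h∈))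

lookup-χ-∉ : ∀ {p : Subset n} {h} → h ∉ p → lookup (χ p) h ≡ 0
lookup-χ-∉ {p = p} {h} h∉ with lookup p h in eq
... | true  = contradiction (lookup⇒[]= h p eq) h∉
... | false = trans (lookup-map h _ p) (cong (if_then 1 else 0) eq)

deg-χ : ∀ (p : Subset n) → deg (χ p) ≡ ∣ p ∣
deg-χ []          = refl
deg-χ (true  ∷ p) = cong suc (deg-χ p)
deg-χ (false ∷ p) = deg-χ p

𝒥-χ : ∀ (p : Subset n) → 𝒥 (χ p) ≡ p
𝒥-χ []          = refl
𝒥-χ (true  ∷ p) = cong (true ∷_) (𝒥-χ p)
𝒥-χ (false ∷ p) = cong (false ∷_) (𝒥-χ p)

χ≤1 : ∀ (p : Subset n) → SquareFree (χ p)
χ≤1 p h with h ∈? p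
... | yes h∈ = ℕ.≤-reflexive (lookup-χ-∈ h∈)
... | no  h∉ = ℕ.≤-trans (ℕ.≤-reflexive (lookup-χ-∉ h∉)) z≤n

χ-coprime : ∀ {p q : Subset n} → (∀ {x} → x ∈ p → x ∉ q) → RelativelyPrime (χ p) (χ q)
χ-coprime {p = p} {q} disj μ μ∣p μ∣q =
  lookup-ext λ h → trans (ℕ.n≤0⇒n≡0 (vanishes h)) (sym (lookup-replicate h 0))
  where
  vanishes : ∀ h → lookup μ h ≤ 0
  vanishes h with h ∈? p
  ... | yes h∈ = ℕ.≤-trans (∣⇒≤ μ∣q h) (ℕ.≤-reflexive (lookup-χ-∉ (disj h∈)))
  ... | no  h∉ = ℕ.≤-trans (∣⇒≤ μ∣p h) (ℕ.≤-reflexive (lookup-χ-∉ h∉))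

-- A variable of odd exponent in both monomials would be a common divisor different from `𝟙`.
coprime⇒𝒥-disjoint : ∀ {α β : Monomial n} → RelativelyPrime α β → ∀ {h} → h ∈ 𝒥 α → h ∉ 𝒥 β
coprime⇒𝒥-disjoint {α = α} {β} coprime {h} h∈α h∈β =
  contradiction (trans (sym (lookup∘update h 𝟙 1))
                       (trans (cong (λ μ → lookup μ h) var≡𝟙) (lookup-replicate h 0))) λ ()
  where
  var∣ : ∀ γ → h ∈ 𝒥 γ → 𝟙 [ h ]≔ 1 ∣ γ
  var∣ γ h∈ = ≤⇒∣ le
    where
    le : ∀ k → lookup (𝟙 [ h ]≔ 1) k ≤ lookup γ k
    le k with k Fin.≟ h
    ... | yes refl = ℕ.≤-trans (ℕ.≤-reflexive (lookup∘update h 𝟙 1)) (x∈𝒥⇒1≤ γ h∈)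
    ... | no  k≢h  = ℕ.≤-trans (ℕ.≤-reflexive (trans (lookup∘update′ k≢h 𝟙 1) (lookup-replicate k 0))) z≤n
  var≡𝟙 : 𝟙 [ h ]≔ 1 ≡ 𝟙
  var≡𝟙 = coprime _ (var∣ α h∈α) (var∣ β h∈β)

𝒥-var² : ∀ (h : Fin n) → 𝒥 (var² h) ≡ 𝒥 𝟙
𝒥-var² zero    = refl
𝒥-var² (suc h) = cong (false ∷_) (𝒥-var² h)

m+m≤n+n⇒m≤n : ∀ {m n} → m + m ≤ n + n → m ≤ n
m+m≤n+n⇒m≤n le = ℕ.≮⇒≥ λ n<m → ℕ.<⇒≱ (ℕ.+-mono-< n<m n<m) le

-- Classes of monomials with equal degree and equal `θ`.

module EdgeClasses (G : Graph) where
  open Graph G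

  degree-△ : ∀ J L v → parity (degree (J △ L) v) ≡ parity (degree J v) ℙ.+ parity (degree L v)
  degree-△ J L v = trans (cong (parity ∘ ∣_∣) (∩-distribʳ-△ (incident v) J L))
    (parity-∣△∣ (J ∩ incident v) (L ∩ incident v))

  oddVertices≡⇒ : ∀ J L → oddVertices J ≡ oddVertices L →
                  ∀ v → parity (degree J v) ≡ parity (degree L v)
  oddVertices≡⇒ J L eq v = isOdd-injective
    (trans (sym (lookup∘tabulate _ v)) (trans (cong (λ T → lookup T v) eq) (lookup∘tabulate _ v)))

  ⇒oddVertices≡ : ∀ J L → (∀ v → parity (degree J v) ≡ parity (degree L v)) →
                  oddVertices J ≡ oddVertices L
  ⇒oddVertices≡ J L eq = tabulate-cong λ v → cong (λ p → does (p Parity.≟ 1ℙ)) (eq v)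

  infix 4 _~_ _~?_
  -- A record, so that `α` and `β` can be inferred from a proof; a plain product of equations would
  -- hide them.
  record _~_ (α β : Monomial #E) : Set where
    constructor _,_
    field
      deg≡ : deg α ≡ deg β
      θ≡   : θ G α ≡ θ G β
  open _~_ public

  _~?_ : ∀ α β → Dec (α ~ β)
  α ~? β = map′ (λ (d , t) → d , t) (λ (d , t) → d , t) $
    deg α ℕ.≟ deg β ×-dec ≡-dec Bool._≟_ (θ G α) (θ G β)

  ~-refl : ∀ {α} → α ~ α
  ~-refl = refl , refl

  ~-sym : ∀ {α β} → α ~ β → β ~ α
  ~-sym (d , t) = sym d , sym t

  ~-trans : ∀ {α β γ} → α ~ β → β ~ γ → α ~ γ
  ~-trans (d , t) (d′ , t′) = trans d d′ , trans t t′

  -- Degrees add, and by `𝒥-·` the parities of the vertex degrees add as well, so a common factor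
  -- shifts both sides alike.
  ~-·ˡ : ∀ ν {α β} → α ~ β → ν · α ~ ν · β
  ~-·ˡ ν {α} {β} (d , t) =
      trans (deg-· ν α) (trans (cong (deg ν +_) d) (sym (deg-· ν β)))
    , ⇒oddVertices≡ (𝒥 (ν · α)) (𝒥 (ν · β)) λ v → trans (split α v)
        (trans (cong (parity (degree (𝒥 ν) v) ℙ.+_) (oddVertices≡⇒ (𝒥 α) (𝒥 β) t v)) (sym (split β v)))
    where
    split : ∀ α v → parity (degree (𝒥 (ν · α)) v) ≡ parity (degree (𝒥 ν) v) ℙ.+ parity (degree (𝒥 α) v)
    split α v = trans (cong (λ J → parity (degree J v)) (𝒥-· ν α)) (degree-△ (𝒥 ν) (𝒥 α) v)

  -- By `parity-∣𝒥∣` this parity is already recorded in the degree.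
  ~⇒parity≡ : ∀ α β → α ~ β → parity ∣ 𝒥 α ∣ ≡ parity ∣ 𝒥 β ∣
  ~⇒parity≡ α β (d , _) = trans (parity-∣𝒥∣ α) (trans (cong parity d) (sym (parity-∣𝒥∣ β)))

  var²-~ : ∀ h ℓ → var² h ~ var² ℓ
  var²-~ h ℓ = trans (deg-[]≔ h 2) (sym (deg-[]≔ ℓ 2))
             , cong oddVertices (trans (𝒥-var² h) (sym (𝒥-var² ℓ)))

  -- Coprimality turns the union of the odd parts into a symmetric difference. Its vertex degrees
  -- are even, so the two summands have equal parity at each vertex.
  EulerianPair⇒~ : ∀ {α β} → EulerianPair G α β → α ~ β
  EulerianPair⇒~ {α} {β} (_ , coprime , _ , _ , d , even , _) = d , ⇒oddVertices≡ (𝒥 α) (𝒥 β) λ v →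
    +-≡0⇒≡ (trans (sym (degree-△ (𝒥 α) (𝒥 β) v))
      (trans (cong (λ J → parity (degree J v))
        (sym (disjoint⇒∪≡△ (coprime⇒𝒥-disjoint {α = α} {β} coprime)))) (even v)))

  -- Vertex degrees and sizes add modulo 2 under `_△_`, so equal parities cancel. Every Eulerian
  -- binomial constructed below splits a subgraph of this kind.
  △-evenEulerian : ∀ J L → oddVertices J ≡ oddVertices L → parity ∣ J ∣ ≡ parity ∣ L ∣ →
                   EvenEulerian (J △ L)
  △-evenEulerian J L odd par =
      (λ v → trans (degree-△ J L v) (≡⇒+-≡0 (oddVertices≡⇒ J L odd v)))
    , trans (parity-∣△∣ J L) (≡⇒+-≡0 par)

  -- Irreducible monomials for a grevlex order.

  module _ (ε : Permutation′ #E) where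
    open Grevlex ε

    -- As the variables decrease along `ε`, this edge carries the smallest variable of `J`.
    IsLast : Subset #E → Fin #E → Set
    IsLast J i = (ε ⟨$⟩ʳ i) ∈ J × (∀ j → i Fin.< j → (ε ⟨$⟩ʳ j) ∉ J)

    -- The first condition says that no t_h² ≻ t_ℓ² divides t^μ.
    Irreducible : Monomial #E → Set
    Irreducible μ = (∀ (i j : Fin #E) → i Fin.< j → lookup μ (ε ⟨$⟩ʳ i) ≤ 1)
                  × (∀ α β → EulerianPair G α β → β ≺ α → ¬ α ∣ μ)

    -- The last position at which the exponents differ is `j`, where only the smaller monomial has a
    -- non-zero exponent.
    var²-≺ : ∀ {i j : Fin #E} → i Fin.< j → var² (ε ⟨$⟩ʳ j) ≺ var² (ε ⟨$⟩ʳ i)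
    var²-≺ {i} {j} i<j = inj₂ (deg≡ (var²-~ (ε ⟨$⟩ʳ j) (ε ⟨$⟩ʳ i)) , j , below , λ k j<k →
        trans (off (ℕ.<-trans i<j j<k)) (sym (off j<k)))
      where
      off : ∀ {a b : Fin #E} → a Fin.< b → lookup (var² (ε ⟨$⟩ʳ a)) (ε ⟨$⟩ʳ b) ≡ 0
      off {a} {b} a<b = trans (lookup∘update′ (distinct a<b) 𝟙 2) (lookup-replicate (ε ⟨$⟩ʳ b) 0)
        where
        distinct : ∀ {a b : Fin #E} → a Fin.< b → ε ⟨$⟩ʳ b ≢ ε ⟨$⟩ʳ a
        distinct a<b eq = Fin.<-irrefl
          (trans (sym (inverseˡ ε)) (trans (cong (ε ⟨$⟩ˡ_) (sym eq)) (inverseˡ ε))) a<b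
      below : lookup (var² (ε ⟨$⟩ʳ i)) (ε ⟨$⟩ʳ j) < lookup (var² (ε ⟨$⟩ʳ j)) (ε ⟨$⟩ʳ j)
      below rewrite off i<j | lookup∘update (ε ⟨$⟩ʳ j) 𝟙 2 = s≤s z≤n

    -- Half of the edges of E, chosen inside A, form the leading monomial: the
    -- last edge of E is in the other half.
    half-of-Eulerian : ∀ {E A μ i} → EvenEulerian E → IsLast E i →
      A ⊆ E → ε ⟨$⟩ʳ i ∉ A → ∣ E ∣ ≤ ∣ A ∣ + ∣ A ∣ → (∀ {h} → h ∈ A → 1 ≤ lookup μ h) →
      ∃[ α ] ∃[ β ] (EulerianPair G α β × β ≺ α × α ∣ μ)
    half-of-Eulerian {E} {A} {μ} {i} even (i∈E , above) A⊆E i∉A ∣E∣≤2∣A∣ supp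
      with k , ∣E∣≡k+k ← parity≡0⇒double ∣ E ∣ (proj₂ even)
      -- Exactly `k` of the `k + k` edges are taken, so that both halves have the same degree; the
      -- bound on `A` ensures that it has that many.
      with H , H⊆A , ∣H∣≡k ← subset-of-size A {k}
             (m+m≤n+n⇒m≤n (subst (_≤ _) ∣E∣≡k+k ∣E∣≤2∣A∣))
      = χ H , χ R , (χH≢χR , χ-coprime disj , χ≤1 H , χ≤1 R , sym degR≡degH , evenHR)
      , inj₂ (degR≡degH , i , χH<χR , agree) , ≤⇒∣ H≤μ
      where
      R : Subset #E
      R = E ─ H
      H⊆E : H ⊆ E
      H⊆E h∈H = A⊆E (H⊆A h∈H)
      disj : ∀ {h} → h ∈ H → h ∉ R
      disj h∈H h∈R = x∈p─q⇒x∉q E H h∈R h∈H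
      i∉H : ε ⟨$⟩ʳ i ∉ H
      i∉H i∈H = i∉A (H⊆A i∈H)
      χH<χR : lookup (χ H) (ε ⟨$⟩ʳ i) < lookup (χ R) (ε ⟨$⟩ʳ i)
      χH<χR rewrite lookup-χ-∉ i∉H | lookup-χ-∈ (x∈p∧x∉q⇒x∈p─q i∈E i∉H) = s≤s z≤n
      χH≢χR : χ H ≢ χ R
      χH≢χR eq = ℕ.<-irrefl (cong (λ μ → lookup μ (ε ⟨$⟩ʳ i)) eq) χH<χR
      degR≡degH : deg (χ R) ≡ deg (χ H)
      degR≡degH = trans (deg-χ R) (trans (ℕ.+-cancelˡ-≡ k _ _
        (trans (trans (cong (_+ ∣ R ∣) (sym ∣H∣≡k)) (q⊆p⇒∣q∣+∣p─q∣≡∣p∣ H⊆E)) ∣E∣≡k+k))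
        (trans (sym ∣H∣≡k) (sym (deg-χ H))))
      evenHR : EvenEulerian (𝒥 (χ H) ∪ 𝒥 (χ R))
      evenHR = subst EvenEulerian
        (sym (trans (cong₂ _∪_ (𝒥-χ H) (𝒥-χ R)) (q⊆p⇒q∪[p─q]≡p H⊆E))) even
      agree : ∀ j → i Fin.< j → lookup (χ H) (ε ⟨$⟩ʳ j) ≡ lookup (χ R) (ε ⟨$⟩ʳ j)
      agree j i<j = trans (lookup-χ-∉ λ j∈H → above j i<j (H⊆E j∈H))
        (sym (lookup-χ-∉ λ j∈R → above j i<j (p─q⊆p E H j∈R)))
      H≤μ : ∀ h → lookup (χ H) h ≤ lookup μ h
      H≤μ h with h ∈? H
      ... | yes h∈H = ℕ.≤-trans (ℕ.≤-reflexive (lookup-χ-∈ h∈H)) (supp (H⊆A h∈H))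
      ... | no  h∉H = ℕ.≤-trans (ℕ.≤-reflexive (lookup-χ-∉ h∉H)) z≤n

    -- Half of the symmetric difference, taken from `A`, lies in `𝒥 μ`. Its monomial therefore
    -- divides `μ` and leads an Eulerian binomial, which irreducibility excludes.
    no-exchange : ∀ μ J {A i} → Irreducible μ → θ G μ ≡ oddVertices J → parity ∣ 𝒥 μ ∣ ≡ parity ∣ J ∣ →
      IsLast (𝒥 μ △ J) i → A ⊆ 𝒥 μ ─ J → ε ⟨$⟩ʳ i ∉ A → ¬ (∣ 𝒥 μ △ J ∣ ≤ ∣ A ∣ + ∣ A ∣)
    no-exchange μ J (_ , irr) odd par isLast A⊆ i∉A large
      with α , β , pair , β≺α , α∣μ ← half-of-Eulerian {μ = μ} (△-evenEulerian (𝒥 μ) J odd par) isLast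
             (p⊆p∪q (J ─ 𝒥 μ) ∘ A⊆) i∉A large (λ h∈A → x∈𝒥⇒1≤ μ (p─q⊆p (𝒥 μ) J (A⊆ h∈A)))
      = irr α β pair β≺α α∣μ

    -- If `J` were smaller, `P` would be larger than `Q` and so hold more than half of the symmetric
    -- difference. Even without the last edge it would supply half, against `no-exchange`.
    irreducible⇒minimum : ∀ μ J → Irreducible μ → θ G μ ≡ oddVertices J →
      parity ∣ 𝒥 μ ∣ ≡ parity ∣ J ∣ → ∣ 𝒥 μ ∣ ≤ ∣ J ∣
    irreducible⇒minimum μ J irr odd par = ℕ.≮⇒≥ smaller-impossible
      where
      P = 𝒥 μ ─ J
      Q = J ─ 𝒥 μ
      smaller-impossible : ¬ (∣ J ∣ < ∣ 𝒥 μ ∣)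
      smaller-impossible ∣J∣<∣𝒥μ∣ with last (λ i → (ε ⟨$⟩ʳ i) ∈? (𝒥 μ △ J))
      ... | inj₁ none = ℕ.<-irrefl (cong ∣_∣ (sym (△-empty⇒≡ λ h h∈ →
              none (ε ⟨$⟩ˡ h) (subst (_∈ _) (sym (inverseʳ ε)) h∈)))) ∣J∣<∣𝒥μ∣
      ... | inj₂ (i , isLast) =
        -- Here `A` is `P` with the last edge deleted, which covers both the case that this edge
        -- lies in `P` and the case that it lies in `Q`.
        no-exchange μ J irr odd par isLast (p─q⊆p P _)
          (λ i∈ → x∈p─q⇒x∉q P _ i∈ (x∈⁅x⁆ (ε ⟨$⟩ʳ i))) large
        where
        ∣Q∣<∣P∣ : ∣ Q ∣ < ∣ P ∣
        ∣Q∣<∣P∣ = ℕ.≰⇒> λ ∣P∣≤∣Q∣ → ℕ.<-irrefl (∣p─q∣+∣q∣≡∣q─p∣+∣p∣ (𝒥 μ) J)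
          (ℕ.+-mono-≤-< ∣P∣≤∣Q∣ ∣J∣<∣𝒥μ∣)
        half<∣P∣ : ∀ {k} → ∣ P ∣ + ∣ Q ∣ ≡ k + k → k < ∣ P ∣
        half<∣P∣ eq = ℕ.≰⇒> λ ∣P∣≤k → ℕ.<-irrefl eq
          (ℕ.+-mono-≤-< ∣P∣≤k (ℕ.<-≤-trans ∣Q∣<∣P∣ ∣P∣≤k))
        large : ∣ 𝒥 μ △ J ∣ ≤ ∣ P - (ε ⟨$⟩ʳ i) ∣ + ∣ P - (ε ⟨$⟩ʳ i) ∣
        large with k , ∣△∣≡k+k ← parity≡0⇒double _ (proj₂ (△-evenEulerian (𝒥 μ) J odd par)) =
          ℕ.≤-trans (ℕ.≤-reflexive ∣△∣≡k+k) (ℕ.+-mono-≤ k≤ k≤)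
          where
          k≤ : k ≤ ∣ P - (ε ⟨$⟩ʳ i) ∣
          -- The strict inequality `k < ∣ P ∣` pays for the one edge deleted.
          k≤ = s≤s⁻¹ (ℕ.≤-trans (half<∣P∣ (trans (sym (∣△∣ (𝒥 μ) J)) ∣△∣≡k+k)) (∣p∣≤1+∣p-x∣ P (ε ⟨$⟩ʳ i)))

    -- Minimality in both directions gives `P` and `Q` the same size, so each is exactly half of the
    -- symmetric difference. If that is non-empty, its last edge lies in one of them and the other
    -- is a half excluded by `no-exchange`.
    irreducible-unique-𝒥 : ∀ μ δ → Irreducible μ → Irreducible δ → μ ~ δ → 𝒥 μ ≡ 𝒥 δ
    irreducible-unique-𝒥 μ δ irr irr′ μ~δ@(_ , odd)
      with last (λ i → (ε ⟨$⟩ʳ i) ∈? (𝒥 μ △ 𝒥 δ))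
    ... | inj₁ none = △-empty⇒≡ λ h h∈ → none (ε ⟨$⟩ˡ h) (subst (_∈ _) (sym (inverseʳ ε)) h∈)
    ... | inj₂ (i , isLast) = ⊥-elim (case (x∈p∪q⁻ (𝒥 μ ─ 𝒥 δ) (𝒥 δ ─ 𝒥 μ) (proj₁ isLast)))
      where
      par = ~⇒parity≡ μ δ μ~δ
      P = 𝒥 μ ─ 𝒥 δ
      Q = 𝒥 δ ─ 𝒥 μ
      ∣𝒥∣≡ : ∣ 𝒥 μ ∣ ≡ ∣ 𝒥 δ ∣
      ∣𝒥∣≡ = ℕ.≤-antisym (irreducible⇒minimum μ (𝒥 δ) irr odd par)
                         (irreducible⇒minimum δ (𝒥 μ) irr′ (sym odd) (sym par))
      ∣P∣≡∣Q∣ : ∣ P ∣ ≡ ∣ Q ∣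
      ∣P∣≡∣Q∣ = ℕ.+-cancelʳ-≡ ∣ 𝒥 δ ∣ _ _
        (trans (∣p─q∣+∣q∣≡∣q─p∣+∣p∣ (𝒥 μ) (𝒥 δ)) (cong (∣ Q ∣ +_) ∣𝒥∣≡))
      case : ε ⟨$⟩ʳ i ∈ P ⊎ ε ⟨$⟩ʳ i ∈ Q → ⊥
      case (inj₂ i∈Q) = no-exchange μ (𝒥 δ) irr odd par isLast (λ h∈ → h∈)
        (λ i∈P → x∈p─q⇒x∉q (𝒥 δ) (𝒥 μ) i∈Q (p─q⊆p (𝒥 μ) (𝒥 δ) i∈P))
        (ℕ.≤-reflexive (trans (∣△∣ (𝒥 μ) (𝒥 δ)) (cong (∣ P ∣ +_) (sym ∣P∣≡∣Q∣))))
      -- The roles of `μ` and `δ` are exchanged, and with them the two parts of the union.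
      case (inj₁ i∈P) = no-exchange δ (𝒥 μ) irr′ (sym odd) (sym par)
        (subst (λ E → IsLast E i) (∪-comm P Q) isLast) (λ h∈ → h∈)
        (λ i∈Q → x∈p─q⇒x∉q (𝒥 μ) (𝒥 δ) i∈P (p─q⊆p (𝒥 δ) (𝒥 μ) i∈Q))
        (ℕ.≤-reflexive (trans (∣△∣ (𝒥 δ) (𝒥 μ)) (cong (∣ Q ∣ +_) ∣P∣≡∣Q∣)))

    -- Exponents away from the last edge are at most 1, hence given by 𝒥; the
    -- degree then determines the exponent of the last edge.
    irreducible-unique : ∀ μ δ → Irreducible μ → Irreducible δ → μ ~ δ → μ ≡ δ
    -- With an always true predicate, `last` returns the greatest index, or reports that there are
    -- no edges at all.
    irreducible-unique μ δ irr irr′ μ~δ with last {P = λ i → i ≡ i} (λ i → yes refl)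
    ... | inj₁ none = lookup-ext λ h → contradiction refl (none (ε ⟨$⟩ˡ h))
    ... | inj₂ (l , _ , above) = deg-injective-at (ε ⟨$⟩ʳ l) agree (deg≡ μ~δ)
      where
      agree : ∀ h → h ≢ ε ⟨$⟩ʳ l → lookup μ h ≡ lookup δ h
      agree h h≢ = subst (λ k → lookup μ k ≡ lookup δ k) (inverseʳ ε)
        (≤1-parity (proj₁ irr i l i<l) (proj₁ irr′ i l i<l)
          (𝒥≡⇒parity≡ {α = μ} {δ} (irreducible-unique-𝒥 μ δ irr irr′ μ~δ) (ε ⟨$⟩ʳ i)))
        where
        i : Fin #E
        i = ε ⟨$⟩ˡ h
        i<l : i Fin.< l
        i<l = Fin.≤∧≢⇒< (ℕ.≮⇒≥ λ l<i → above i l<i refl)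
                (λ i≡l → h≢ (trans (sym (inverseʳ ε)) (cong (ε ⟨$⟩ʳ_) i≡l)))
        ≤1-parity : ∀ {a b} → a ≤ 1 → b ≤ 1 → parity a ≡ parity b → a ≡ b
        ≤1-parity {0} {0} _ _ _ = refl
        ≤1-parity {1} {1} _ _ _ = refl
        ≤1-parity {suc (suc _)} (s≤s ()) _ _
        ≤1-parity {_} {suc (suc _)} _ (s≤s ()) _

does-true⇒ : ∀ {a} {A : Set a} (a? : Dec A) → does a? ≡ true → A
does-true⇒ (yes a) _ = a

-- Sums of coefficients of polynomials over a Heyting field.

module DivisionRemainders {c ℓ₁ ℓ₂} (K : HeytingField c ℓ₁ ℓ₂) where
  open Polynomials K
  private
    module K = HeytingField K
    module R = CommutativeRing (HeytingCommutativeRing.commutativeRing (HeytingField.heytingCommutativeRing K))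
  open HeytingProperties K.heytingCommutativeRing using (1#0; #-congʳ)
  open RingProperties R.ring using (-0#≈0#; -‿+-comm; x∙y⁻¹≈ε⇒x≈y)
  open CommutativeSemigroupProperties R.+-commutativeSemigroup using (x∙yz≈y∙xz)
  open import Relation.Binary.Reasoning.Setoid R.setoid

  ¬#⇒≈ : ∀ {x y} → ¬ (x K.# y) → x K.≈ y
  ¬#⇒≈ = proj₁ (K.tight _ _)

  ≈0⇒¬# : ∀ {x} → x K.≈ K.0# → ¬ (x K.# K.0#)
  ≈0⇒¬# = K.#-irrefl

  -- Cotransitivity compares `x + y` and `0#` with `y`. If `x + y` is apart from `y`, their
  -- difference is invertible, and that difference is `x`.
  #-+ : ∀ {x y} → (x K.+ y) K.# K.0# → x K.# K.0# ⊎ y K.# K.0#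
  #-+ {x} {y} x+y#0 with K.#-cotrans x+y#0 y
  ... | inj₂ y#0   = inj₂ y#0
  ... | inj₁ x+y#y = inj₁ (K.invertible⇒# (proj₁ inv , (begin
          proj₁ inv K.* (x K.- K.0#)       ≈⟨ R.*-congˡ shift ⟨
          proj₁ inv K.* (x K.+ y K.- y)    ≈⟨ proj₁ (proj₂ inv) ⟩
          K.1#                             ∎) , (begin
          (x K.- K.0#) K.* proj₁ inv       ≈⟨ R.*-congʳ shift ⟨
          (x K.+ y K.- y) K.* proj₁ inv    ≈⟨ proj₂ (proj₂ inv) ⟩
          K.1#                             ∎)))
    where
    inv = K.#⇒invertible x+y#y
    shift : x K.+ y K.- y K.≈ x K.- K.0#
    shift = begin
      x K.+ y K.- y        ≈⟨ R.+-assoc x y (K.- y) ⟩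
      x K.+ (y K.- y)      ≈⟨ R.+-congˡ (R.-‿inverseʳ y) ⟩
      x K.+ K.0#           ≈⟨ R.+-congˡ -0#≈0# ⟨
      x K.- K.0#           ∎

  when : Bool → K.Carrier → K.Carrier
  when b a = if b then a else K.0#

  module _ {s : ℕ} where

    -- The sum runs over the listed terms, repetitions included, which makes it additive in the
    -- list; that it respects `_≈_` is `mass-cong`.
    mass : (Monomial s → Bool) → Polynomial s → K.Carrier
    mass p []            = K.0#
    mass p ((a , α) ∷ f) = when (p α) a K.+ mass p f

    coeff≡mass : ∀ f μ → coeff f μ ≡ mass (λ α → does (α ≟ μ)) f
    coeff≡mass []            μ = refl
    coeff≡mass ((a , α) ∷ f) μ = cong (when (does (α ≟ μ)) a K.+_) (coeff≡mass f μ)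

    mass-⊕ : ∀ p f g → mass p (f ⊕ g) K.≈ mass p f K.+ mass p g
    mass-⊕ p []            g = R.sym (R.+-identityˡ _)
    mass-⊕ p ((a , α) ∷ f) g = R.trans (R.+-congˡ (mass-⊕ p f g)) (R.sym (R.+-assoc _ _ _))

    mass-⊖ : ∀ p f g → mass p (f ⊖ g) K.≈ mass p f K.- mass p g
    mass-⊖ p f g = R.trans (mass-⊕ p f _) (R.+-congˡ (negated g))
      where
      negated : ∀ g → mass p (List.map (λ (b , β) → (K.- b , β)) g) K.≈ K.- mass p g
      negated []            = R.sym -0#≈0#
      negated ((b , β) ∷ g) = R.trans (R.+-cong (when-neg (p β)) (negated g)) (-‿+-comm _ _)
        where
        when-neg : ∀ x → when x (K.- b) K.≈ K.- when x b
        when-neg true  = R.refl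
        when-neg false = R.sym -0#≈0#

    mass-t^ : ∀ p α → mass p (t^ α) K.≈ when (p α) K.1#
    mass-t^ p α = R.+-identityʳ _

    coeff-⊖ : ∀ f g μ → coeff (f ⊖ g) μ K.≈ coeff f μ K.- coeff g μ
    coeff-⊖ f g μ rewrite coeff≡mass (f ⊖ g) μ | coeff≡mass f μ | coeff≡mass g μ =
      mass-⊖ (λ α → does (α ≟ μ)) f g

    infixl 6 _except_
    _except_ : (Monomial s → Bool) → Monomial s → Monomial s → Bool
    (p except α) β = p β ∧ not (does (β ≟ α))

    -- Repeated terms at `α` merge into one coefficient, so that apartness from `0#` can be examined
    -- on coefficients rather than on listed terms.
    mass-pick : ∀ p α f → mass p f K.≈ when (p α) (coeff f α) K.+ mass (p except α) f
    mass-pick p α [] = R.sym (R.trans (R.+-identityʳ _) (when-0 (p α)))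
      where
      when-0 : ∀ x → when x K.0# K.≈ K.0#
      when-0 true  = R.refl
      when-0 false = R.refl
    mass-pick p α ((b , β) ∷ f) with β ≟ α
    ... | yes refl rewrite Bool.∧-zeroʳ (p β) = begin
          when (p β) b K.+ mass p f
            ≈⟨ R.+-congˡ (mass-pick p β f) ⟩
          when (p β) b K.+ (when (p β) (coeff f β) K.+ mass (p except β) f)
            ≈⟨ R.+-assoc _ _ _ ⟨
          when (p β) b K.+ when (p β) (coeff f β) K.+ mass (p except β) f
            ≈⟨ R.+-cong (when-+ (p β)) (R.sym (R.+-identityˡ _)) ⟩
          when (p β) (b K.+ coeff f β) K.+ (K.0# K.+ mass (p except β) f) ∎
      where
      when-+ : ∀ x → when x b K.+ when x (coeff f β) K.≈ when x (b K.+ coeff f β)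
      when-+ true  = R.refl
      when-+ false = R.+-identityˡ _
    ... | no _ rewrite Bool.∧-identityʳ (p β) = begin
          when (p β) b K.+ mass p f
            ≈⟨ R.+-congˡ (mass-pick p α f) ⟩
          when (p β) b K.+ (when (p α) (coeff f α) K.+ mass (p except α) f)
            ≈⟨ x∙yz≈y∙xz _ _ _ ⟩
          when (p α) (coeff f α) K.+ (when (p β) b K.+ mass (p except α) f)
            ≈⟨ R.+-congʳ (when-cong (p α) (R.sym (R.+-identityˡ _))) ⟩
          when (p α) (K.0# K.+ coeff f α) K.+ (when (p β) b K.+ mass (p except α) f) ∎
      where
      when-cong : ∀ x {a b} → a K.≈ b → when x a K.≈ when x b
      when-cong true  eq = eq
      when-cong false _  = R.refl

    mass#0⇒occurs : ∀ p f → mass p f K.# K.0# → ∃[ α ] (p α ≡ true × α OccursIn f)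
    mass#0⇒occurs p [] 0#0 = contradiction 0#0 (≈0⇒¬# R.refl)
    mass#0⇒occurs p F@((a , α) ∷ f) mass#0
      with #-+ (#-congʳ (mass-pick p α F) mass#0)
    ... | inj₁ here#0 with p α in pα
    ...   | true  = α , pα , here#0
    ...   | false = contradiction here#0 (≈0⇒¬# R.refl)
    mass#0⇒occurs p F@((a , α) ∷ f) mass#0 | inj₂ rest#0
      -- Excluding `α` turns the first term into `0#`, so the rest is a mass over the tail `f`.
      rewrite dec-true (α ≟ α) refl | Bool.∧-zeroʳ (p α)
      with mass#0⇒occurs (p except α) f (#-congʳ (R.+-identityˡ _) rest#0)
    ...   | β , pβ , β∈f = β , Bool.∧-conicalˡ _ _ pβ , #-congʳ (R.sym coeff≈) β∈f
      where
      -- Since `p except α` holds at `β`, the two monomials differ and the first term adds `0#`.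
      coeff≈ : coeff F β K.≈ coeff f β
      coeff≈ with β ≟ α
      ... | yes refl = contradiction (trans (sym (Bool.∧-zeroʳ (p β))) pβ) λ ()
      ... | no β≢α rewrite dec-false (α ≟ β) (β≢α ∘ sym) = R.+-identityˡ _

    -- By tightness it suffices to refute apartness from `0#`, which would exhibit a forbidden
    -- monomial.
    mass≈0 : ∀ p f → (∀ α → p α ≡ true → ¬ α OccursIn f) → mass p f K.≈ K.0#
    mass≈0 p f none = ¬#⇒≈ λ mass#0 →
      let α , pα , α∈f = mass#0⇒occurs p f mass#0 in none α pα α∈f

    -- No monomial occurs in `f ⊖ g`, so its mass vanishes.
    mass-cong : ∀ p f g → f ≈ g → mass p f K.≈ mass p g
    mass-cong p f g f≈g = x∙y⁻¹≈ε⇒x≈y _ _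
      (R.trans (R.sym (mass-⊖ p f g)) (mass≈0 p (f ⊖ g) λ α _ → ≈0⇒¬# (begin
        coeff (f ⊖ g) α            ≈⟨ coeff-⊖ f g α ⟩
        coeff f α K.- coeff g α    ≈⟨ R.+-congʳ (f≈g α) ⟩
        coeff g α K.- coeff g α    ≈⟨ R.-‿inverseʳ _ ⟩
        K.0#                       ∎)))

    -- Each term of `q` moves `α` and `β` to monomials that `p` treats alike, and their coefficients
    -- are opposite.
    mass-⊛≈0 : ∀ p q g α β → g ≈ t^ α ⊖ t^ β → (∀ ν → p (ν · α) ≡ p (ν · β)) →
               mass p (q ⊛ g) K.≈ K.0#
    mass-⊛≈0 p []            g α β g≈ same = R.refl
    mass-⊛≈0 p ((a , ν) ∷ q) g α β g≈ same = begin
      mass p (((a , ν) ∷ q) ⊛ g)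
        ≈⟨ mass-⊕ p (List.map (λ (b , μ) → (a K.* b , ν · μ)) g) (q ⊛ g) ⟩
      mass p (List.map (λ (b , μ) → (a K.* b , ν · μ)) g) K.+ mass p (q ⊛ g)
        ≈⟨ R.+-cong (term g) (mass-⊛≈0 p q g α β g≈ same) ⟩
      a K.* mass (λ μ → p (ν · μ)) g K.+ K.0#
        ≈⟨ R.+-identityʳ _ ⟩
      a K.* mass (λ μ → p (ν · μ)) g
        ≈⟨ R.*-congˡ vanishes ⟩
      a K.* K.0#
        ≈⟨ R.zeroʳ a ⟩
      K.0# ∎
      where
      term : ∀ g → mass p (List.map (λ (b , μ) → (a K.* b , ν · μ)) g) K.≈
                   a K.* mass (λ μ → p (ν · μ)) g
      term []            = R.sym (R.zeroʳ a)
      term ((b , μ) ∷ g) = R.trans (R.+-cong (when-* (p (ν · μ))) (term g)) (R.sym (R.distribˡ a _ _))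
        where
        when-* : ∀ x → when x (a K.* b) K.≈ a K.* when x b
        when-* true  = R.refl
        when-* false = R.sym (R.zeroʳ a)
      vanishes : mass (λ μ → p (ν · μ)) g K.≈ K.0#
      vanishes = begin
        mass pν g                              ≈⟨ mass-cong pν g (t^ α ⊖ t^ β) g≈ ⟩
        mass pν (t^ α ⊖ t^ β)                  ≈⟨ mass-⊖ pν (t^ α) (t^ β) ⟩
        mass pν (t^ α) K.- mass pν (t^ β)      ≈⟨ R.+-cong (mass-t^ pν α) (R.-‿cong (mass-t^ pν β)) ⟩
        when (pν α) K.1# K.- when (pν β) K.1#  ≡⟨ cong (λ x → when x K.1# K.- when (pν β) K.1#) (same ν) ⟩
        when (pν β) K.1# K.- when (pν β) K.1#  ≈⟨ R.-‿inverseʳ _ ⟩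
        K.0#                                   ∎
        where
        pν : Monomial s → Bool
        pν μ = p (ν · μ)

    mass-∑≈0 : ∀ p {k} (f : Fin k → Polynomial s) → (∀ i → mass p (f i) K.≈ K.0#) →
               mass p (∑ f) K.≈ K.0#
    mass-∑≈0 p {zero}  f zeros = R.refl
    mass-∑≈0 p {suc k} f zeros = R.trans (mass-⊕ p (f zero) _)
      (R.trans (R.+-cong (zeros zero) (mass-∑≈0 p (f ∘ suc) (zeros ∘ suc))) (R.+-identityˡ _))

    coeff-binomial : ∀ α β μ → coeff (t^ α ⊖ t^ β) μ K.≈
                     when (does (α ≟ μ)) K.1# K.- when (does (β ≟ μ)) K.1#
    coeff-binomial α β μ = R.trans (coeff-⊖ (t^ α) (t^ β) μ)
      (R.+-cong (R.+-identityʳ _) (R.-‿cong (R.+-identityʳ _)))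

    occurs-binomial : ∀ g α β {μ} → g ≈ t^ α ⊖ t^ β → μ OccursIn g → μ ≡ α ⊎ μ ≡ β
    occurs-binomial g α β {μ} g≈ μ∈g with α ≟ μ | β ≟ μ | R.trans (g≈ μ) (coeff-binomial α β μ)
    ... | yes α≡μ | _       | _  = inj₁ (sym α≡μ)
    ... | no _    | yes β≡μ | _  = inj₂ (sym β≡μ)
    ... | no _    | no _    | eq = contradiction μ∈g (≈0⇒¬# (R.trans eq (R.-‿inverseʳ _)))

    module _ (ε : Permutation′ s) where
      open Grevlex ε
      open Division ε

      -- As `β` differs from `α`, the coefficient at `α` is `1#`, which is apart from `0#`.
      binomial-leading : ∀ {α β} → α ≢ β → β ≺ α → IsLeadingMonomial (t^ α ⊖ t^ β) α
      binomial-leading {α} {β} α≢β β≺α = #-congʳ (R.sym coeff≈1) 1#0 , below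
        where
        coeff≈1 : coeff (t^ α ⊖ t^ β) α K.≈ K.1#
        coeff≈1 with eq ← coeff-binomial α β α
          rewrite dec-true (α ≟ α) refl | dec-false (β ≟ α) (α≢β ∘ sym) =
          R.trans eq (R.trans (R.+-congˡ -0#≈0#) (R.+-identityʳ _))
        below : ∀ ν → ν OccursIn (t^ α ⊖ t^ β) → ν ≼ α
        below ν ν∈ with occurs-binomial (t^ α ⊖ t^ β) α β (λ _ → R.refl) ν∈
        ... | inj₁ ν≡α  = inj₂ ν≡α
        ... | inj₂ refl = inj₁ β≺α

  -- Divisions and remainders with respect to `𝒢`.

  module _ (G : Graph) where
    open Graph G
    open EdgeClasses G

    𝒢⇒binomial : ∀ g → 𝒢 G g → ∃[ α ] ∃[ β ] (α ~ β × g ≈ t^ α ⊖ t^ β)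
    𝒢⇒binomial _ (inj₁ (h , ℓ , g≈))        = var² h , var² ℓ , var²-~ h ℓ , g≈
    𝒢⇒binomial _ (inj₂ (α , β , pair , g≈)) = α , β , EulerianPair⇒~ pair , g≈

    module _ (ε : Permutation′ #E) where
      open Grevlex ε
      open Division ε

      -- The leading and the other monomial of `g` are, in one order or the other, two equivalent
      -- monomials, and the cofactor `ν` preserves the equivalence.
      division-~ : ∀ g {γ δ} → 𝒢 G g → DivisionBy g γ δ → δ ~ γ
      division-~ g g∈𝒢 (lead , other , ν , (lead∈g , _) , other∈g , other≢lead , refl , refl)
        with α , β , α~β , g≈ ← 𝒢⇒binomial g g∈𝒢
        with occurs-binomial g α β g≈ lead∈g | occurs-binomial g α β g≈ other∈g
      ... | inj₁ refl | inj₁ refl = contradiction refl other≢lead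
      ... | inj₁ refl | inj₂ refl = ~-·ˡ ν (~-sym α~β)
      ... | inj₂ refl | inj₁ refl = ~-·ˡ ν α~β
      ... | inj₂ refl | inj₂ refl = contradiction refl other≢lead

      module _ {γ r} (standard : StandardExpression (𝒢 G) (t^ γ) r) where
        open StandardExpression standard

        -- The two conditions are `reduced` applied to the binomials of `𝒯` and of `ℰ` respectively.
        occurs⇒irreducible : ∀ {μ} → μ OccursIn r → Irreducible ε μ
        occurs⇒irreducible {μ} μ∈r = small , λ α β pair β≺α → reduced μ μ∈r (t^ α ⊖ t^ β) α
          (inj₂ (α , β , pair , λ _ → R.refl)) (binomial-leading ε (proj₁ pair) β≺α)
          where
          small : ∀ (i j : Fin #E) → i Fin.< j → lookup μ (ε ⟨$⟩ʳ i) ≤ 1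
          small i j i<j = ℕ.≮⇒≥ λ 2≤μ → reduced μ μ∈r
            (t^ (var² (ε ⟨$⟩ʳ i)) ⊖ t^ (var² (ε ⟨$⟩ʳ j))) (var² (ε ⟨$⟩ʳ i))
            (inj₁ (ε ⟨$⟩ʳ i , ε ⟨$⟩ʳ j , λ _ → R.refl))
            (binomial-leading ε (≺⇒≢ {β = var² (ε ⟨$⟩ʳ j)} (var²-≺ ε i<j)) (var²-≺ ε i<j))
            (≤⇒∣ (var²≤μ 2≤μ))
            where
            ≺⇒≢ : ∀ {α β} → β ≺ α → α ≢ β
            ≺⇒≢ (inj₁ deg<)            refl = ℕ.<-irrefl refl deg<
            ≺⇒≢ (inj₂ (_ , _ , < , _)) refl = ℕ.<-irrefl refl <
            var²≤μ : 2 ≤ lookup μ (ε ⟨$⟩ʳ i) → ∀ h → lookup (var² (ε ⟨$⟩ʳ i)) h ≤ lookup μ h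
            var²≤μ 2≤μ h with h Fin.≟ ε ⟨$⟩ʳ i
            ... | yes refl = ℕ.≤-trans (ℕ.≤-reflexive (lookup∘update h 𝟙 2)) 2≤μ
            ... | no  h≢   = ℕ.≤-trans (ℕ.≤-reflexive
                               (trans (lookup∘update′ h≢ 𝟙 2) (lookup-replicate h 0))) z≤n

        class : Monomial #E → Monomial #E → Bool
        class μ α = does (μ ~? α)

        class⇒~ : ∀ μ α → class μ α ≡ true → μ ~ α
        class⇒~ μ α = does-true⇒ (μ ~? α)

        -- A monomial factor keeps the two terms of an element of `𝒢` in one class, so each
        -- `q i ⊛ g i` has class sum zero and `r` inherits the class sum of `t^ γ`.
        mass-remainder : ∀ μ → mass (class μ) r K.≈ when (class μ γ) K.1#
        mass-remainder μ = R.sym (begin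
          when (class μ γ) K.1#
            ≈⟨ mass-t^ (class μ) γ ⟨
          mass (class μ) (t^ γ)
            ≈⟨ mass-cong (class μ) (t^ γ) (∑ (λ i → q i ⊛ g i) ⊕ r) expression ⟩
          mass (class μ) (∑ (λ i → q i ⊛ g i) ⊕ r)
            ≈⟨ mass-⊕ (class μ) (∑ (λ i → q i ⊛ g i)) r ⟩
          mass (class μ) (∑ (λ i → q i ⊛ g i)) K.+ mass (class μ) r
            ≈⟨ R.+-congʳ (mass-∑≈0 (class μ) (λ i → q i ⊛ g i) killed) ⟩
          K.0# K.+ mass (class μ) r
            ≈⟨ R.+-identityˡ _ ⟩
          mass (class μ) r ∎)
          where
          killed : ∀ i → mass (class μ) (q i ⊛ g i) K.≈ K.0#
          killed i with α , β , α~β , g≈ ← 𝒢⇒binomial (g i) (g∈B i) =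
            mass-⊛≈0 (class μ) (q i) (g i) α β g≈ λ ν → does-⇔
              (mk⇔ (λ μ~ → ~-trans μ~ (~-·ˡ ν α~β))
                   (λ μ~ → ~-trans μ~ (~-·ˡ ν (~-sym α~β))))
              (μ ~? (ν · α)) (μ ~? (ν · β))

        -- By `irreducible-unique` no other monomial of the class of `μ` occurs in `r`, so the class
        -- sum reduces to one coefficient.
        coeff-remainder : ∀ {μ} → μ OccursIn r → coeff r μ K.≈ when (class μ γ) K.1#
        coeff-remainder {μ} μ∈r = begin
          coeff r μ
            ≡⟨ cong (λ b → when b (coeff r μ)) (dec-true (μ ~? μ) ~-refl) ⟨
          when (class μ μ) (coeff r μ)
            ≈⟨ R.+-identityʳ _ ⟨
          when (class μ μ) (coeff r μ) K.+ K.0#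
            ≈⟨ R.+-congˡ (mass≈0 (class μ except μ) r alone) ⟨
          when (class μ μ) (coeff r μ) K.+ mass (class μ except μ) r
            ≈⟨ mass-pick (class μ) μ r ⟨
          mass (class μ) r
            ≈⟨ mass-remainder μ ⟩
          when (class μ γ) K.1# ∎
          where
          alone : ∀ α → (class μ except μ) α ≡ true → ¬ α OccursIn r
          alone α eq α∈r with α ≟ μ
          ... | yes refl = contradiction (trans (sym (Bool.∧-zeroʳ (class μ α))) eq) λ ()
          ... | no α≢μ = α≢μ (sym (irreducible-unique ε μ α (occurs⇒irreducible μ∈r)
                  (occurs⇒irreducible α∈r) (class⇒~ μ α (Bool.∧-conicalˡ _ _ eq))))

        -- The sum of `r` over the class of `γ` is `1#`, hence apart from `0#`.
        remainder-occurs : ∃[ δ ] (class γ δ ≡ true × δ OccursIn r)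
        remainder-occurs = mass#0⇒occurs (class γ) r (#-congʳ (R.sym mass≈1) 1#0)
          where
          mass≈1 : mass (class γ) r K.≈ K.1#
          mass≈1 = R.trans (mass-remainder γ)
            (R.reflexive (cong (λ b → when b K.1#) (dec-true (γ ~? γ) ~-refl)))

        -- A monomial occurring in `r` equals `δ` if it lies in the class of `γ`; in any other class
        -- its coefficient would be zero.
        remainder≈t^ : ∀ {δ} → γ ~ δ → δ OccursIn r → r ≈ t^ δ
        remainder≈t^ {δ} γ~δ δ∈r ν with δ ≟ ν
        ... | yes refl = begin
              coeff r δ              ≈⟨ coeff-remainder δ∈r ⟩
              when (class δ γ) K.1#  ≡⟨ cong (λ b → when b K.1#) (dec-true (δ ~? γ) (~-sym γ~δ)) ⟩
              K.1#                   ≈⟨ R.+-identityʳ _ ⟨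
              K.1# K.+ K.0#          ∎
        ... | no δ≢ν = R.trans (¬#⇒≈ absent) (R.sym (R.+-identityʳ _))
          where
          absent : ¬ ν OccursIn r
          absent ν∈r with class ν γ in νγ | coeff-remainder ν∈r
          ... | true  | _  = δ≢ν (sym (irreducible-unique ε ν δ
                  (occurs⇒irreducible ν∈r) (occurs⇒irreducible δ∈r) (~-trans (class⇒~ ν γ νγ) γ~δ)))
          ... | false | eq = ≈0⇒¬# eq ν∈r

theorem4p3 :
    ∀ {c ℓ₁ ℓ₂} (K : HeytingField c ℓ₁ ℓ₂) (G : Graph) →
    let open Graph G
        open Polynomials K
    in
    NoIsolatedVertices →
    1 < #E →
    (ε : Permutation′ #E) →
    let open Division ε in
    (∀ γ δ g → 𝒢 G g → DivisionBy g γ δ →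
      θ G δ ≡ θ G γ × parity ∣ 𝒥 δ ∣ ≡ parity ∣ 𝒥 γ ∣)
    ×
    (∀ γ r → StandardExpression (𝒢 G) (t^ γ) r →
      ∃[ δ ] (r ≈ t^ δ
        × IsMinimum
            (λ k → ∃[ J ] (IsJoin (θ G γ) J
                           × parity ∣ J ∣ ≡ parity ∣ 𝒥 γ ∣
                           × ∣ J ∣ ≡ k))
            ∣ 𝒥 δ ∣))
theorem4p3 K G _ _ ε = division , remainder
  where
  open Graph G
  open Polynomials K
  open Division ε
  open EdgeClasses G
  open DivisionRemainders K

  division : ∀ γ δ g → 𝒢 G g → DivisionBy g γ δ →
             θ G δ ≡ θ G γ × parity ∣ 𝒥 δ ∣ ≡ parity ∣ 𝒥 γ ∣
  division γ δ g g∈𝒢 div = θ≡ δ~γ , ~⇒parity≡ δ γ δ~γ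
    where
    δ~γ : δ ~ γ
    δ~γ = division-~ G ε g g∈𝒢 div

  remainder : ∀ γ r → StandardExpression (𝒢 G) (t^ γ) r →
    ∃[ δ ] (r ≈ t^ δ × IsMinimum (λ k → ∃[ J ] (IsJoin (θ G γ) J
              × parity ∣ J ∣ ≡ parity ∣ 𝒥 γ ∣ × ∣ J ∣ ≡ k)) ∣ 𝒥 δ ∣)
  remainder γ r standard with δ , γδ , δ∈r ← remainder-occurs G ε standard =
    δ , remainder≈t^ G ε standard γ~δ δ∈r
      -- The minimum is attained by `𝒥 δ` itself, a join of the required parity because `δ` is
      -- equivalent to `γ`.
      , (𝒥 δ , θ≡ γ~δ , sym (~⇒parity≡ γ δ γ~δ) , refl)
      , λ { _ (J , join , par , refl) →
            irreducible⇒minimum ε δ J (occurs⇒irreducible G ε standard δ∈r)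
              (trans (sym (θ≡ γ~δ)) join)
              (trans (sym (~⇒parity≡ γ δ γ~δ)) (sym par)) }
    where
    γ~δ : γ ~ δ
    γ~δ = class⇒~ G ε standard γ δ γδ
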